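{- For the rhombus game on the triangular grid with $n$ winning sets, $\mathrm{SC}(\mathcal G_{\lozenge},4)\ge \frac{n}{78}-o(n)$.
   Context: An $s$-of-$k$ game on a $k$-uniform hypergraph $(V,\mathcal F)$ (winning sets are $k$-element subsets of the finite set $V$), $1\le s\le k$: Maker and Breaker alternately claim unclaimed vertices, Maker first, until all are claimed; the score is the number of winning sets in which Maker claimed at least $s$ vertices (Maker maximizes, Breaker minimizes). $\mathrm{SC}(\mathcal H,s)$ is the score under optimal play of both players. $\mathcal G_{\lozenge}$ is the hypergraph whose vertices are the points of a finite portion of the triangular lattice and whose winning sets are the vertex sets of all rhombi formed by two unit triangles sharing an edge, in all three orientations, so $k=4$. Grids are assumed "two-dimensional": the number of winning sets within constant distance of the boundary is $o(n)$, where $n$ is the number of winning sets; $o(n)$ refers to $n\to\infty$. -}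

module Defs where

open import Data.Bool using (Bool; true; false; if_then_else_)
open import Data.Nat using (ℕ; zero; suc; _⊔_; _⊓_; _≤_; _≤ᵇ_)
open import Data.Integer as ℤ using (ℤ; +_; _+_; _-_; -_; ∣_∣)
import Data.Integer.Properties as ℤP
open import Data.Product using (_×_; _,_)
open import Data.Product.Properties using (≡-dec)
open import Data.List using (List; []; _∷_; map; filter; length; foldr; concatMap; upTo)
open import Relation.Binary.Definitions using (DecidableEquality)
open import Relation.Nullary.Decidable using (⌊_⌋)
import Data.List.Membership.DecPropositional as DecMem

-- Points of the triangular lattice.
-- A lattice point a·e₁ + b·e₂ (e₁ = (1,0), e₂ = (1/2, √3/2)) is encoded as
-- the pair (a , b) ∈ ℤ × ℤ.  The six lattice neighbours of (a,b) are
-- (a,b) ± (1,0), ± (0,1), ± (-1,1).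

Pt : Set
Pt = ℤ × ℤ

_≟ₚ_ : DecidableEquality Pt
_≟ₚ_ = ≡-dec ℤP._≟_ ℤP._≟_

open DecMem _≟ₚ_ using (_∈?_) public

_⊕_ : Pt → Pt → Pt
(a , b) ⊕ (c , d) = (a + c , b + d)

-- graph distance in the triangular lattice: max(|x|,|y|,|x+y|)
hexNorm : Pt → ℕ
hexNorm (x , y) = ∣ x ∣ ⊔ ∣ y ∣ ⊔ ∣ x + y ∣

score : List (List Pt) → ℕ → List Pt → ℕ
score F s M = length (filter (λ W → s Data.Nat.≤? length (filter (_∈? M) W)) F)

picks : {A : Set} → List A → List (A × List A)
picks [] = []
picks (x ∷ xs) = (x , xs) ∷ map (λ { (y , r) → (y , x ∷ r) }) (picks xs)

-- value of the game under optimal play.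
-- fuel = number of unclaimed vertices; Bool = true iff Maker is to move;
-- M = vertices claimed by Maker; U = unclaimed vertices.
-- (Breaker's vertices do not influence the score, so they are not stored.)
gameValue : List (List Pt) → ℕ → ℕ → Bool → List Pt → List Pt → ℕ
gameValue F s zero _ M U = score F s M
gameValue F s (suc f) mk M U = go (picks U)
  where
  next : Pt × List Pt → ℕ
  next (x , r) = if mk then gameValue F s f false (x ∷ M) r
                       else gameValue F s f true M r
  go : List (Pt × List Pt) → ℕ
  go [] = score F s M
  go (c ∷ cs) = foldr (λ c' acc → if mk then next c' ⊔ acc else next c' ⊓ acc) (next c) cs

SC : List Pt → List (List Pt) → ℕ → ℕ
SC V F s = gameValue F s (length V) true [] V

p : ℤ → ℤ → Pt
p a b = (a , b)

-- the three rhombi "anchored" at (a,b), one per orientation; every rhombus of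
-- the lattice arises from exactly one anchor and orientation.
rhombiAt : Pt → List (List Pt)
rhombiAt (a , b) =
    (p a b ∷ p (a + + 1) b ∷ p a (b + + 1) ∷ p (a + + 1) (b + + 1) ∷ [])
  ∷ (p a b ∷ p (a + + 1) b ∷ p a (b + + 1) ∷ p (a + + 1) (b - + 1) ∷ [])
  ∷ (p a b ∷ p (a + + 1) b ∷ p a (b + + 1) ∷ p (a - + 1) (b + + 1) ∷ [])
  ∷ []

allIn : List Pt → List Pt → Bool
allIn V [] = true
allIn V (q ∷ W) = ⌊ q ∈? V ⌋ Data.Bool.∧ allIn V W

rhombi : List Pt → List (List Pt)
rhombi V = filter (λ W → Data.Bool._≟_ (allIn V W) true) (concatMap rhombiAt V)

nWin : List Pt → ℕ
nWin V = length (rhombi V)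

range : ℕ → List ℤ
range d = map (λ i → + i - + d) (upTo (suc (d Data.Nat.+ d)))

ball : ℕ → Pt → List Pt
ball d w = map (w ⊕_)
  (filter (λ q → hexNorm q Data.Nat.≤? d)
    (concatMap (λ x → map (λ y → (x , y)) (range d)) (range d)))

nearBoundary : ℕ → List Pt → List Pt → Bool
nearBoundary d V W = if allIn V (concatMap (ball d) W) then false else true

nBoundary : ℕ → List Pt → ℕ
nBoundary d V = length (filter (λ W → Data.Bool._≟_ (nearBoundary d V W) true) (rhombi V))

{-# OPTIONS --safe #-}

-- On a Star of David of 13 lattice points Maker, moving first, completes a rhombus.
-- Translates of the star tile the plane, and each carries the anchors of 39 rhombi,
-- so n − o(n) ≤ 39 · (number of stars inside the board).  Maker answers a Breaker
-- move in an already opened star there, and any other Breaker move by opening an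
-- untouched star; thus Maker wins at least every second star.
module Submission where

open import Defs
import Data.Bool as Bool
open import Data.Bool using (true; false)
open import Data.Integer as ℤ using (ℤ; +_; _-_; -_)
import Data.Integer.Properties as ℤ
import Algebra.Properties.AbelianGroup ℤ.+-0-abelianGroup as ℤGroup
open import Data.Integer.Divisibility.Signed using (_∣_; _∣?_; divides; ∣m∣n⇒∣m+n; ∣m∣n⇒∣m-n)
open import Data.Integer.DivMod using (_%ℕ_; _/ℕ_; n%ℕd<d; a≡a%ℕn+[a/ℕn]*n)
open import Data.Integer.Tactic.RingSolver using (solve-∀)
open import Data.List
  using (List; []; _∷_; _++_; [_]; map; filter; length; foldr; concat; concatMap; upTo; deduplicate)
open import Data.List.Membership.Propositional using (_∈_; _∉_; find)
open import Data.List.Membership.Propositional.Properties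
open import Data.List.Properties using (filter-++; filter-all; length-++; length-map; length-filter)
open import Data.List.Relation.Binary.Disjoint.Propositional using (Disjoint)
open import Data.List.Relation.Binary.Permutation.Propositional
  using (_↭_; prep; swap; ↭-refl; ↭-sym; ↭-trans)
open import Data.List.Relation.Binary.Permutation.Propositional.Properties
  using (shift; ↭-length; ∈-resp-↭)
open import Data.List.Relation.Binary.Subset.Propositional using (_⊆_)
import Data.List.Relation.Binary.Subset.Propositional.Properties as Subset
open import Data.List.Relation.Unary.All as All using (All; []; _∷_; all?)
import Data.List.Relation.Unary.All.Properties as All
open import Data.List.Relation.Unary.AllPairs using (AllPairs; []; _∷_)
import Data.List.Relation.Unary.AllPairs.Properties as AllPairs
open import Data.List.Relation.Unary.Any as Any using (Any; here; there; any?)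
open import Data.List.Relation.Unary.Unique.DecPropositional.Properties _≟ₚ_ using (deduplicate-!)
open import Data.List.Relation.Unary.Unique.Propositional using (Unique)
import Data.List.Relation.Unary.Unique.Propositional.Properties as Unique
open import Data.Maybe using (Maybe; just; nothing; from-just)
open import Data.Nat as ℕ
  using (ℕ; zero; suc; _+_; _*_; _∸_; _⊔_; _⊓_; _≤_; _<_; _≥_; z≤n; s≤s)
open import Data.Nat.Properties
open import Data.Nat.Tactic.RingSolver using () renaming (solve-∀ to ℕ-solve-∀)
open import Data.Product using (Σ; ∃-syntax; _×_; _,_; proj₁; proj₂)
open import Data.Sum as Sum using (_⊎_; inj₁; inj₂)
open import Function using (_∘_; id)
open import Relation.Binary.PropositionalEquality
  using (_≡_; _≢_; refl; sym; trans; cong; cong₂; subst)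
open import Relation.Nullary using (Dec; yes; no; ¬?; contradiction; _→-dec_)
open import Relation.Nullary.Decidable using (from-yes)

-- Finite lists: pigeonhole, legal moves, extremal options

Unique-⊆⇒length-≤ : ∀ {A : Set} {xs ys : List A} → Unique xs → xs ⊆ ys → length xs ≤ length ys
Unique-⊆⇒length-≤ [] _ = z≤n
Unique-⊆⇒length-≤ {xs = x ∷ xs} (x∉xs ∷ xs!) xs⊆ys
  with ps , qs , refl ← ∈-∃++ (xs⊆ys (here refl)) =
  subst (suc (length xs) ≤_) (sym (↭-length (shift x ps qs)))
    (s≤s (Unique-⊆⇒length-≤ xs! xs⊆ps++qs))
  where
  xs⊆ps++qs : xs ⊆ ps ++ qs
  xs⊆ps++qs z∈xs with ∈-resp-↭ (shift x ps qs) (xs⊆ys (there z∈xs))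
  ... | here refl = contradiction refl (All.lookup x∉xs z∈xs)
  ... | there z∈ = z∈

picks-↭ : ∀ {A : Set} {x : A} {r} U → (x , r) ∈ picks U → x ∷ r ↭ U
picks-↭ (u ∷ U) (here refl) = ↭-refl
picks-↭ (u ∷ U) (there c∈) with (y , r) , yr∈ , refl ← ∈-map⁻ _ c∈ =
  ↭-trans (swap y u ↭-refl) (prep u (picks-↭ U yr∈))

∈-picks : ∀ {A : Set} {x : A} {U} → x ∈ U → ∃[ r ] (x , r) ∈ picks U
∈-picks (here refl) = _ , here refl
∈-picks (there x∈U) = _ , there (∈-map⁺ _ (proj₂ (∈-picks x∈U)))

module _ {A : Set} (h : A → ℕ) where

  ≤-foldr-⊔ : ∀ {a b} as → b ∈ a ∷ as → h b ≤ foldr (λ c acc → h c ⊔ acc) (h a) as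
  ≤-foldr-⊔ [] (here refl) = ≤-refl
  ≤-foldr-⊔ (c ∷ as) (here refl) = ≤-trans (≤-foldr-⊔ as (here refl)) (m≤n⊔m (h c) _)
  ≤-foldr-⊔ (c ∷ as) (there (here refl)) = m≤m⊔n (h c) _
  ≤-foldr-⊔ (c ∷ as) (there (there b∈)) = ≤-trans (≤-foldr-⊔ as (there b∈)) (m≤n⊔m (h c) _)

  -- A minimum is one of its arguments, so whatever holds of every Breaker option holds of the
  -- value.
  foldr-⊓-satisfies : ∀ (P : ℕ → Set) {a} as → (∀ {b} → b ∈ a ∷ as → P (h b)) →
    P (foldr (λ c acc → h c ⊓ acc) (h a) as)
  foldr-⊓-satisfies P [] Ph = Ph (here refl)
  foldr-⊓-satisfies P {a} (c ∷ as) Ph with ⊓-sel (h c) (foldr (λ c acc → h c ⊓ acc) (h a) as)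
  ... | inj₁ eq = subst P (sym eq) (Ph (there (here refl)))
  ... | inj₂ eq = subst P (sym eq) (foldr-⊓-satisfies P as λ where
    (here refl) → Ph (here refl)
    (there b∈) → Ph (there (there b∈)))

-- Strategies within one region

-- Maker, holding H, completes a set of Line using only the points of S besides
-- H, whatever Breaker answers: Maker is to move in an Attack, Breaker in a
-- Defence.  After any Breaker move x, some attack whose support avoids x remains.
mutual
  data Attack (Line : List Pt → Set) (H S : List Pt) : Set where
    play : ∀ y → y ∈ S → Defence Line (y ∷ H) S → Attack Line H S

  data Defence (Line : List Pt → Set) (H S : List Pt) : Set where
    won  : ∀ {W} → Line W → W ⊆ H → Defence Line H S
    fork : (∀ x → ∃[ S′ ] S′ ⊆ S × x ∉ S′ × Attack Line H S′) → Defence Line H S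

origin : Pt
origin = + 0 , + 0

module _ {Line : List Pt → Set} {X : List Pt} where
  mutual
    -- Meant for the end of the game: once the whole support is Maker's, any path through the
    -- strategy tree reaches a `won` leaf, and no play has to be reconstructed.
    attack-completes : ∀ {H S} → H ⊆ X → S ⊆ X → Attack Line H S → ∃[ W ] Line W × W ⊆ X
    attack-completes H⊆X S⊆X (play y y∈S d) =
      defence-completes (λ { (here refl) → S⊆X y∈S ; (there q∈H) → H⊆X q∈H }) S⊆X d

    defence-completes : ∀ {H S} → H ⊆ X → S ⊆ X → Defence Line H S → ∃[ W ] Line W × W ⊆ X
    defence-completes H⊆X _ (won l W⊆H) = _ , l , H⊆X ∘ W⊆H
    -- `origin` is a dummy Breaker move: any branch will do, since each has its support inside `X`.
    defence-completes H⊆X S⊆X (fork f) with S′ , S′⊆S , _ , a ← f origin =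
      attack-completes H⊆X (S⊆X ∘ S′⊆S) a

-- Sums of games on disjoint regions

module SumOfGames (F : List (List Pt)) (s : ℕ) (1≤s : 1 ≤ s) where

  Scoring : List Pt → Set
  Scoring W = W ∈ F × s ≤ length W

  -- Breaker's points are not recorded, so "not Breaker's" is expressed as Maker's or unclaimed.
  -- Allowing Maker's own points in `S` lets the record survive every claim by Maker.
  record Local (M U R H S : List Pt) : Set where
    field
      held   : H ⊆ M
      held⊆R : H ⊆ R
      supp⊆R : S ⊆ R
      supp-reachable  : ∀ {q} → q ∈ S → q ∈ M ⊎ q ∈ U

  open Local

  -- The index is twice the value of a region to Maker: a region in which Maker
  -- wins only by moving first is worth a half.
  data Status (M U R : List Pt) : ℕ → Set where
    lost      : Status M U R 0
    attacking : ∀ {H S} → Local M U R H S → Attack Scoring H S → Status M U R 1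
    defending : ∀ {H S} → Local M U R H S → Defence Scoring H S → Status M U R 2

  data Statuses (M U : List Pt) : List (List Pt) → ℕ → Set where
    []  : Statuses M U [] 0
    _∷_ : ∀ {R Rs k w} → Status M U R k → Statuses M U Rs w → Statuses M U (R ∷ Rs) (k + w)

  Local-claim : ∀ {M U R H S y r} → y ∷ r ↭ U → Local M U R H S → Local (y ∷ M) r R H S
  Local-claim {M} {U} {S = S} {y} {r} yr l = record
    { held = there ∘ held l ; held⊆R = held⊆R l ; supp⊆R = supp⊆R l ; supp-reachable = o }
    where
    o : ∀ {q} → q ∈ S → q ∈ y ∷ M ⊎ q ∈ r
    o q∈S with supp-reachable l q∈S
    ... | inj₁ q∈M = inj₁ (there q∈M)
    ... | inj₂ q∈U with ∈-resp-↭ (↭-sym yr) q∈U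
    ...   | here refl = inj₁ (here refl)
    ...   | there q∈r = inj₂ q∈r

  claim : ∀ {M U R k y r} → y ∷ r ↭ U → Status M U R k → Status (y ∷ M) r R k
  claim yr lost = lost
  claim yr (attacking l a) = attacking (Local-claim yr l) a
  claim yr (defending l d) = defending (Local-claim yr l) d

  claim-all : ∀ {M U Rs w y r} → y ∷ r ↭ U → Statuses M U Rs w → Statuses (y ∷ M) r Rs w
  claim-all yr [] = []
  claim-all yr (st ∷ sts) = claim yr st ∷ claim-all yr sts

  Local-avoid : ∀ {M U R H S S′ x r} → x ∷ r ↭ U → S′ ⊆ S → x ∉ S′ →
    Local M U R H S → Local M r R H S′
  Local-avoid {M} {U} {S′ = S′} {x} {r} xr S′⊆S x∉S′ l = record
    { held = held l ; held⊆R = held⊆R l ; supp⊆R = supp⊆R l ∘ S′⊆S ; supp-reachable = o }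
    where
    o : ∀ {q} → q ∈ S′ → q ∈ M ⊎ q ∈ r
    o q∈S′ with supp-reachable l (S′⊆S q∈S′)
    ... | inj₁ q∈M = inj₁ q∈M
    ... | inj₂ q∈U with ∈-resp-↭ (↭-sym xr) q∈U
    ...   | here refl = contradiction q∈S′ x∉S′
    ...   | there q∈r = inj₂ q∈r

  untouched : ∀ {M U R k x r} → x ∷ r ↭ U → x ∉ R → Status M U R k → Status M r R k
  untouched xr x∉R lost = lost
  untouched xr x∉R (attacking l a) = attacking (Local-avoid xr id (x∉R ∘ supp⊆R l) l) a
  untouched xr x∉R (defending l d) = defending (Local-avoid xr id (x∉R ∘ supp⊆R l) l) d

  untouched-all : ∀ {M U Rs w x r} → x ∷ r ↭ U → All (x ∉_) Rs → Statuses M U Rs w → Statuses M r Rs w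
  untouched-all xr [] [] = []
  untouched-all xr (x∉R ∷ x∉Rs) (st ∷ sts) = untouched xr x∉R st ∷ untouched-all xr x∉Rs sts

  -- A Breaker move costs at most a half: an attack may be lost, a fork falls back to an attack, a
  -- completed set stays completed.
  hit : ∀ {M U R k x r} → x ∷ r ↭ U → Status M U R k → ∃[ k′ ] Status M r R k′ × k ≤ suc k′
  hit xr lost = _ , lost , z≤n
  hit xr (attacking _ _) = _ , lost , ≤-refl
  -- A completed set requires no further points, so the support shrinks to `[]`, which avoids `x`
  -- trivially.
  hit xr (defending l (won W W⊆H)) =
    _ , defending (Local-avoid {S′ = []} xr (λ ()) (λ ()) l) (won W W⊆H) , n≤1+n 2
  hit {x = x} xr (defending l (fork f)) with S′ , S′⊆S , x∉S′ , a ← f x =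
    _ , attacking (Local-avoid xr S′⊆S x∉S′ l) a , ≤-refl

  -- Disjointness confines `x` to at most one region, so the half is lost only once.
  hit-all : ∀ {M U Rs w x r} → x ∷ r ↭ U → AllPairs Disjoint Rs → Statuses M U Rs w →
    ∃[ w′ ] Statuses M r Rs w′ × w ≤ suc w′
  hit-all xr [] [] = _ , [] , z≤n
  hit-all {x = x} xr (R#Rs ∷ Rs#) (_∷_ {R = R} {k = k} {w = w} st sts) with x ∈? R
  ... | yes x∈R with k′ , st′ , k≤ ← hit xr st =
    _ , st′ ∷ untouched-all xr (All.map (λ R#R′ x∈R′ → R#R′ (x∈R , x∈R′)) R#Rs) sts
      , +-monoˡ-≤ w k≤
  ... | no x∉R with w′ , sts′ , w≤ ← hit-all xr Rs# sts =
    _ , untouched xr x∉R st ∷ sts′ , ≤-trans (+-monoʳ-≤ k w≤) (≤-reflexive (+-suc k w′))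

  Local-play : ∀ {M U R H S y} → y ∈ S → y ∈ M → Local M U R H S → Local M U R (y ∷ H) S
  Local-play y∈S y∈M l = record
    { held = λ { (here refl) → y∈M ; (there q∈H) → held l q∈H }
    ; held⊆R = λ { (here refl) → supp⊆R l y∈S ; (there q∈H) → held⊆R l q∈H }
    ; supp⊆R = supp⊆R l
    ; supp-reachable = supp-reachable l }

  -- `settle` yields `calm` when every region is lost or defended; of this only the even total is
  -- retained, for rounding later. A `move` gains at least a half.
  data Settled (M U : List Pt) (Rs : List (List Pt)) (w : ℕ) : Set where
    calm : ∀ a → Statuses M U Rs (2 * a) → w ≤ 2 * a → Settled M U Rs w
    move : ∀ y → y ∈ U →
      (∀ {r} → y ∷ r ↭ U → ∃[ w′ ] Statuses (y ∷ M) r Rs w′ × w < w′) → Settled M U Rs w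

  -- The point required by an attack may already be Maker's; then the attack has
  -- become a defence without costing a move.
  settle : ∀ {M U Rs w} → Statuses M U Rs w → Settled M U Rs w

  -- The region is worth `k` before and 2 after, which covers both a region already defended and an
  -- attack promoted without a move.
  settle-defended : ∀ {M U R Rs k w} → Status M U R 2 → k ≤ 2 → Settled M U Rs w →
    Settled M U (R ∷ Rs) (k + w)
  settle-defended st k≤2 (calm a sts w≤) =
    calm (suc a) (subst (Statuses _ _ _) (sym (*-suc 2 a)) (st ∷ sts))
      (≤-trans (+-mono-≤ k≤2 w≤) (≤-reflexive (sym (*-suc 2 a))))
  settle-defended st k≤2 (move y y∈U f) = move y y∈U λ yr →
    let _ , sts , w< = f yr in _ , claim yr st ∷ sts , +-mono-≤-< k≤2 w<

  settle [] = calm 0 [] z≤n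
  settle (lost ∷ sts) with settle sts
  ... | calm a sts′ w≤ = calm a (lost ∷ sts′) w≤
  ... | move y y∈U f = move y y∈U λ yr → let _ , sts′ , w< = f yr in _ , lost ∷ sts′ , w<
  settle (defending l d ∷ sts) = settle-defended (defending l d) ≤-refl (settle sts)
  settle (attacking l (play y y∈S d) ∷ sts) with supp-reachable l y∈S
  ... | inj₁ y∈M = settle-defended (defending (Local-play y∈S y∈M l) d) (s≤s z≤n) (settle sts)
  ... | inj₂ y∈U = move y y∈U λ yr →
    _ , defending (Local-play y∈S (here refl) (Local-claim yr l)) d ∷ claim-all yr sts , ≤-refl

  record Harvest (M : List Pt) (Rs : List (List Pt)) (w : ℕ) : Set where
    field
      sets     : List (List Pt)
      distinct : Unique sets
      scoring  : All (λ W → Scoring W × W ⊆ M) sets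
      located  : All (λ W → Any (W ⊆_) Rs) sets
      enough   : w ≤ 2 * length sets

  open Harvest

  Local-full : ∀ {M R H S} → Local M [] R H S → H ⊆ filter (_∈? M) R × S ⊆ filter (_∈? M) R
  Local-full l =
      (λ q∈H → ∈-filter⁺ (_∈? _) (held⊆R l q∈H) (held l q∈H))
    , (λ q∈S → ∈-filter⁺ (_∈? _) (supp⊆R l q∈S) (Sum.[ id , (λ ()) ] (supp-reachable l q∈S)))

  harvest-set : ∀ {M R Rs k w} → All (Disjoint R) Rs → k ≤ 2 →
    ∃[ W ] Scoring W × W ⊆ filter (_∈? M) R → Harvest M Rs w → Harvest M (R ∷ Rs) (k + w)
  harvest-set {M} {R} R#Rs k≤2 (W , W-scores , W⊆) h = record
    { sets     = W ∷ sets h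
    ; distinct = All.map fresh (located h) ∷ distinct h
    ; scoring  = (W-scores , proj₂ ∘ split) ∷ scoring h
    ; located  = here (proj₁ ∘ split) ∷ All.map there (located h)
    ; enough   = ≤-trans (+-mono-≤ k≤2 (enough h)) (≤-reflexive (sym (*-suc 2 (length (sets h)))))
    }
    where
    split : ∀ {q} → q ∈ W → q ∈ R × q ∈ M
    split q∈W = ∈-filter⁻ (_∈? M) {xs = R} (W⊆ q∈W)

    nonempty : ∀ W → s ≤ length W → ∃[ q ] q ∈ W
    nonempty []      s≤0 = contradiction (≤-trans 1≤s s≤0) λ ()
    nonempty (q ∷ _) _   = q , here refl

    -- By `1≤s` a scoring set is nonempty, so it cannot lie in two disjoint regions.
    fresh : ∀ {W′} → Any (W′ ⊆_) _ → W ≢ W′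
    fresh W⊆Rs refl with q , q∈W ← nonempty W (proj₂ W-scores)
                       | R#R′ , W⊆R′ ← All.lookupAny R#Rs W⊆Rs = R#R′ (proj₁ (split q∈W) , W⊆R′ q∈W)

  harvest-cons : ∀ {M R Rs k w} → All (Disjoint R) Rs → Status M [] R k → Harvest M Rs w →
    Harvest M (R ∷ Rs) (k + w)
  harvest-cons _ lost h = record
    { sets = sets h ; distinct = distinct h ; scoring = scoring h
    ; located = All.map there (located h) ; enough = enough h }
  -- With nothing left unclaimed even an attack owns its whole support, so its half is rounded up to
  -- a full set.
  harvest-cons R#Rs (attacking l a) with H⊆ , S⊆ ← Local-full l =
    harvest-set R#Rs (s≤s z≤n) (attack-completes H⊆ S⊆ a)
  harvest-cons R#Rs (defending l d) with H⊆ , S⊆ ← Local-full l =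
    harvest-set R#Rs ≤-refl (defence-completes H⊆ S⊆ d)

  harvest : ∀ {M Rs w} → AllPairs Disjoint Rs → Statuses M [] Rs w → Harvest M Rs w
  harvest [] [] = record { sets = [] ; distinct = [] ; scoring = [] ; located = [] ; enough = z≤n }
  harvest (R#Rs ∷ Rs#) (st ∷ sts) = harvest-cons R#Rs st (harvest Rs# sts)

  final-score : ∀ {M Rs w} → AllPairs Disjoint Rs → Statuses M [] Rs w → w ≤ 2 * score F s M
  final-score {M} Rs# sts = ≤-trans (enough h) (*-monoʳ-≤ 2 (Unique-⊆⇒length-≤ (distinct h) counted))
    where
    h = harvest Rs# sts
    counted : sets h ⊆ filter (λ W → s ℕ.≤? length (filter (_∈? M) W)) F
    counted {W} W∈ with (W∈F , s≤W) , W⊆M ← All.lookup (scoring h) W∈ =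
      ∈-filter⁺ (λ W → s ℕ.≤? length (filter (_∈? M) W)) W∈F
        (subst (λ W → s ≤ length W) (sym (filter-all (_∈? M) (All.tabulate W⊆M))) s≤W)

  -- Bounds on the value of the game

  ≤-maker-value : ∀ {f M U x r} → (x , r) ∈ picks U →
    gameValue F s f false (x ∷ M) r ≤ gameValue F s (suc f) true M U
  ≤-maker-value {U = _ ∷ U} c∈ = ≤-foldr-⊔ _ _ c∈

  breaker-value-satisfies : ∀ (P : ℕ → Set) {f M u U} →
    (∀ {x r} → (x , r) ∈ picks (u ∷ U) → P (gameValue F s f true M r)) →
    P (gameValue F s (suc f) false M (u ∷ U))
  breaker-value-satisfies P Pv = foldr-⊓-satisfies _ P _ Pv

  module _ {Rs : List (List Pt)} (Rs# : AllPairs Disjoint Rs) where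
    mutual
      -- The half that Maker gains pays for the half that Breaker can take next, whence the slack of
      -- one in `breaker-bound`.
      maker-bound : ∀ f {M U w} → length U ≡ f → Statuses M U Rs w →
        w ≤ 2 * gameValue F s f true M U
      maker-bound zero {U = []} _ sts = final-score Rs# sts
      maker-bound (suc f) {M} {u ∷ U} eq sts with settle sts
      -- Maker claims the first unclaimed point as a waiting move, harmless by `claim-all`. Parity
      -- absorbs the slack: 2a ≤ 1 + 2v forces a ≤ v.
      ... | calm a sts′ w≤ = ≤-trans w≤ (*-monoʳ-≤ 2 (≤-trans a≤v (≤-maker-value {f} (here refl))))
        where
        v = gameValue F s f false (u ∷ M) U
        a≤v : a ≤ v
        a≤v = ≤-pred (*-cancelˡ-< 2 a (suc v) (≤-trans
          (s≤s (breaker-bound f (suc-injective eq) (claim-all ↭-refl sts′)))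
          (≤-reflexive (sym (*-suc 2 v)))))
      ... | move y y∈U g
        with r , yr∈ ← ∈-picks y∈U
        with yr ← picks-↭ (u ∷ U) yr∈
        with w′ , sts′ , w<w′ ← g yr =
        ≤-trans
          (≤-pred (≤-trans w<w′ (breaker-bound f (suc-injective (trans (↭-length yr) eq)) sts′)))
          (*-monoʳ-≤ 2 (≤-maker-value {f} yr∈))

      breaker-bound : ∀ f {M U w} → length U ≡ f → Statuses M U Rs w →
        w ≤ suc (2 * gameValue F s f false M U)
      breaker-bound zero {U = []} _ sts = m≤n⇒m≤1+n (final-score Rs# sts)
      breaker-bound (suc f) {M} {u ∷ U} {w} eq sts =
        breaker-value-satisfies (λ v → w ≤ suc (2 * v)) {f} λ {x} {r} xr∈ →
          let xr = picks-↭ (u ∷ U) xr∈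
              w′ , sts′ , w≤ = hit-all xr Rs# sts
          in ≤-trans w≤ (s≤s (maker-bound f (suc-injective (trans (↭-length xr) eq)) sts′))

  Winnable : List Pt → Set
  Winnable R = ∃[ S ] S ⊆ R × Attack Scoring [] S

  initial : ∀ {V Rs} → All (_⊆ V) Rs → All Winnable Rs → Statuses [] V Rs (length Rs)
  initial [] [] = []
  initial (R⊆V ∷ Rs⊆V) ((S , S⊆R , a) ∷ as) = attacking l a ∷ initial Rs⊆V as
    where
    l = record { held = λ () ; held⊆R = λ () ; supp⊆R = S⊆R ; supp-reachable = inj₂ ∘ R⊆V ∘ S⊆R }

  regions≤2*SC : ∀ {V Rs} → AllPairs Disjoint Rs → All (_⊆ V) Rs → All Winnable Rs →
    length Rs ≤ 2 * SC V F s
  regions≤2*SC {V} Rs# Rs⊆V as = maker-bound Rs# (length V) refl (initial Rs⊆V as)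

-- Translations of the lattice

infixl 6 _⊖_
_⊖_ : Pt → Pt → Pt
(a , b) ⊖ (c , d) = (a - c , b - d)

⊕-⊖ : ∀ t q → (t ⊕ q) ⊖ t ≡ q
⊕-⊖ (a , b) (c , d) = cong₂ _,_ (eq a c) (eq b d)
  where
  eq : ∀ x y → (x ℤ.+ y) - x ≡ y
  eq = solve-∀

⊖-⊕ : ∀ v o → (v ⊖ o) ⊕ o ≡ v
⊖-⊕ (a , b) (c , d) = cong₂ _,_ (eq a c) (eq b d)
  where
  eq : ∀ x y → (x - y) ℤ.+ y ≡ x
  eq = solve-∀

⊖-⊕-comm : ∀ v o o′ → (v ⊖ o) ⊕ o′ ≡ v ⊕ (o′ ⊖ o)
⊖-⊕-comm (a , b) (c , d) (e , f) = cong₂ _,_ (eq a c e) (eq b d f)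
  where
  eq : ∀ x y z → (x - y) ℤ.+ z ≡ x ℤ.+ (z - y)
  eq = solve-∀

⊕-cancelʳ : ∀ o {t t′} → t ⊕ o ≡ t′ ⊕ o → t ≡ t′
⊕-cancelʳ (c , d) eq = cong₂ _,_ (ℤGroup.∙-cancelʳ c _ _ (cong proj₁ eq)) (ℤGroup.∙-cancelʳ d _ _ (cong proj₂ eq))

-- Breaker's move is translated back, answered there, and the answer translated forth; one strategy
-- on the star thus serves every tile.
translate-attack : ∀ {Line Line′} t → (∀ {W} → Line W → Line′ (map (t ⊕_) W)) →
  ∀ {H S} → Attack Line H S → Attack Line′ (map (t ⊕_) H) (map (t ⊕_) S)

translate-defence : ∀ {Line Line′} t → (∀ {W} → Line W → Line′ (map (t ⊕_) W)) →
  ∀ {H S} → Defence Line H S → Defence Line′ (map (t ⊕_) H) (map (t ⊕_) S)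

translate-attack t l (play y y∈S d) = play (t ⊕ y) (∈-map⁺ (t ⊕_) y∈S) (translate-defence t l d)

translate-defence t l (won W W⊆H) = won (l W) (Subset.map⁺ (t ⊕_) W⊆H)
translate-defence t l (fork f) = fork λ x →
  let S′ , S′⊆S , x∉S′ , a = f (x ⊖ t) in
    map (t ⊕_) S′ , Subset.map⁺ (t ⊕_) S′⊆S
  , (λ x∈ → let q , q∈S′ , x≡ = ∈-map⁻ (t ⊕_) x∈ in
      x∉S′ (subst (_∈ S′) (sym (trans (cong (_⊖ t) x≡) (⊕-⊖ t q))) q∈S′))
  , translate-attack t l a

-- Finite strategy trees and their verification

-- Maker claims the point of the root and answers a Breaker move x by a subplan whose
-- support avoids x; at a leaf the point of the root completes a winning set.
data Plan : Set where
  node : Pt → List Plan → Plan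

mutual
  support : Plan → List Pt
  support (node y ps) = y ∷ concat (supports ps)

  supports : List Plan → List (List Pt)
  supports [] = []
  supports (p ∷ ps) = support p ∷ supports ps

-- A move outside `A` is answered by the first branch, so escape has to be checked only for the
-- finitely many points of `A`. This makes the fork decidable.
play-fork : ∀ {Line H A As} y → All (Attack Line (y ∷ H)) (A ∷ As) →
  All (λ x → Any (x ∉_) (A ∷ As)) A → Attack Line H (y ∷ concat (A ∷ As))
play-fork {A = A} {As} y (a ∷ as) escape = play y (here refl) (fork respond)
  where
  attacks : ∀ {S′} → S′ ∈ A ∷ As → Attack _ _ S′
  attacks = All.lookup (a ∷ as)
  respond : ∀ x → ∃[ S′ ] S′ ⊆ y ∷ concat (A ∷ As) × x ∉ S′ × Attack _ _ S′
  respond x with x ∈? A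
  ... | no x∉A = A , there ∘ ∈-++⁺ˡ , x∉A , a
  ... | yes x∈A with S′ , S′∈ , x∉S′ ← find (All.lookup escape x∈A) =
    S′ , (λ q∈ → there (∈-concat⁺′ q∈ S′∈)) , x∉S′ , attacks S′∈

module _ (L : List (List Pt)) where
  mutual
    execute : ∀ H p → Maybe (Attack (_∈ L) H (support p))
    execute H (node y []) with any? (all? (_∈? (y ∷ H))) L
    ... | yes W⊆H = let W , W∈L , W⊆ = find W⊆H in just (play y (here refl) (won W∈L (All.lookup W⊆)))
    ... | no _ = nothing
    execute H (node y (p ∷ ps))
      with executeAll (y ∷ H) (p ∷ ps)
         | all? (λ x → any? (λ S → ¬? (x ∈? S)) (supports (p ∷ ps))) (support p)
    ... | just as | yes escape = just (play-fork y as escape)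
    ... | _ | _ = nothing

    executeAll : ∀ H ps → Maybe (All (Attack (_∈ L) H) (supports ps))
    executeAll H [] = just []
    executeAll H (p ∷ ps) with execute H p | executeAll H ps
    ... | just a | just as = just (a ∷ as)
    ... | _ | _ = nothing

-- The Star of David

-- The rotation by 60° is multiplication by e₂ on the Eisenstein integers.
ring : ℕ → Pt
ring zero = + 1 , + 0
ring (suc k) = let (a , b) = ring k in - b , a ℤ.+ b

star : List Pt
star = origin ∷ map ring (upTo 6) ++ map (λ k → ring k ⊕ ring (suc k)) (upTo 6)

-- Holding the origin and two consecutive ring points, Maker threatens two rhombi: one
-- with the next ring point and one with the tip between the two.  The two branches of
-- a spoke are disjoint, and the spoke along ring i avoids ring (3 + i).
branch : ℕ → ℕ → ℕ → Plan
branch i j k = node (ring j) (node (ring k) [] ∷ node (ring i ⊕ ring j) [] ∷ [])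

spoke : ℕ → Plan
-- `ring` has period six, so `5 + i` and `4 + i` are one and two steps backwards: the branches turn
-- in opposite senses.
spoke i = node (ring i) (branch i (1 + i) (2 + i) ∷ branch i (5 + i) (4 + i) ∷ [])

starPlan : Plan
starPlan = node origin (map spoke (upTo 6))

star-attack : Attack (_∈ rhombi star) [] (support starPlan)
star-attack = from-just (execute (rhombi star) [] starPlan)

support⊆star : support starPlan ⊆ star
support⊆star = All.lookup (from-yes (all? (_∈? star) (support starPlan)))

-- Rhombi on a board

allIn⁻ : ∀ V W → allIn V W ≡ true → W ⊆ V
allIn⁻ V (q ∷ W) eq x∈ with q ∈? V
allIn⁻ V (q ∷ W) eq (here refl) | yes q∈V = q∈V
allIn⁻ V (q ∷ W) eq (there x∈) | yes q∈V = allIn⁻ V W eq x∈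

allIn⁺ : ∀ V W → W ⊆ V → allIn V W ≡ true
allIn⁺ V [] W⊆V = refl
allIn⁺ V (q ∷ W) W⊆V with q ∈? V
... | yes _ = allIn⁺ V W (W⊆V ∘ there)
... | no q∉V = contradiction (W⊆V (here refl)) q∉V

rhombiAt-head : ∀ {v W} → W ∈ rhombiAt v → v ∈ W
rhombiAt-head (here refl) = here refl
rhombiAt-head (there (here refl)) = here refl
rhombiAt-head (there (there (here refl))) = here refl

rhombiAt-length : ∀ {v W} → W ∈ rhombiAt v → length W ≡ 4
rhombiAt-length (here refl) = refl
rhombiAt-length (there (here refl)) = refl
rhombiAt-length (there (there (here refl))) = refl

rhombiAt-⊕ : ∀ t v → map (map (t ⊕_)) (rhombiAt v) ≡ rhombiAt (t ⊕ v)
rhombiAt-⊕ (a , b) (c , d)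
  rewrite ℤ.+-assoc a c (+ 1) | ℤ.+-assoc b d (+ 1) | ℤ.+-assoc a c (- + 1) | ℤ.+-assoc b d (- + 1) = refl

∈-rhombi⁻ : ∀ {V W} → W ∈ rhombi V → W ⊆ V × ∃[ v ] W ∈ rhombiAt v
∈-rhombi⁻ {V} {W} W∈ with W∈c , eq ← ∈-filter⁻ (λ W → allIn V W Bool.≟ true) {xs = concatMap rhombiAt V} W∈ =
  allIn⁻ V W eq , (let v , _ , W∈v = find (∈-concatMap⁻ rhombiAt {xs = V} W∈c) in v , W∈v)

∈-rhombi⁺ : ∀ {V W v} → W ⊆ V → W ∈ rhombiAt v → W ∈ rhombi V
∈-rhombi⁺ {V} {W} W⊆V W∈v = ∈-filter⁺ (λ W → allIn V W Bool.≟ true)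
  (∈-concatMap⁺ rhombiAt (Any.map (λ { refl → W∈v }) (W⊆V (rhombiAt-head W∈v))))
  (allIn⁺ V W W⊆V)

tile : Pt → List Pt
tile t = map (t ⊕_) star

tile-winnable : ∀ {V} t → tile t ⊆ V → SumOfGames.Winnable (rhombi V) 4 (s≤s z≤n) (tile t)
tile-winnable {V} t t⊆V = _ , Subset.map⁺ (t ⊕_) support⊆star , translate-attack t line star-attack
  where
  line : ∀ {W} → W ∈ rhombi star → map (t ⊕_) W ∈ rhombi V × 4 ≤ length (map (t ⊕_) W)
  line {W} W∈ with W⊆star , v , W∈v ← ∈-rhombi⁻ {star} W∈ =
      ∈-rhombi⁺ {v = t ⊕ v} (t⊆V ∘ Subset.map⁺ (t ⊕_) W⊆star)
        (subst (map (t ⊕_) W ∈_) (rhombiAt-⊕ t v) (∈-map⁺ (map (t ⊕_)) W∈v))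
    , ≤-reflexive (sym (trans (length-map (t ⊕_) W) (rhombiAt-length W∈v)))

-- Tiling by stars

-- The star is a complete residue system modulo the index-13 sublattice
-- 13 ∣ a + 4b, so its translates by this sublattice tile the lattice.
height : Pt → ℤ
height (a , b) = a ℤ.+ + 4 ℤ.* b

height-⊖ : ∀ v w → height (v ⊖ w) ≡ height v - height w
height-⊖ (a , b) (c , d) = eq a b c d
  where
  eq : ∀ a b c d → (a - c) ℤ.+ + 4 ℤ.* (b - d) ≡ (a ℤ.+ + 4 ℤ.* b) - (c ℤ.+ + 4 ℤ.* d)
  eq = solve-∀

height-⊕ : ∀ v w → height (v ⊕ w) ≡ height v ℤ.+ height w
height-⊕ (a , b) (c , d) = eq a b c d
  where
  eq : ∀ a b c d → (a ℤ.+ c) ℤ.+ + 4 ℤ.* (b ℤ.+ d) ≡ (a ℤ.+ + 4 ℤ.* b) ℤ.+ (c ℤ.+ + 4 ℤ.* d)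
  eq = solve-∀

-- The heights on the star are 0, ±1, ±4, ±3, ±5, ±7, ±2; since 7 ≡ -6, each class modulo 13 occurs
-- once.
star-residues : All (λ r → Any (λ o → + 13 ∣ + r - height o) star) (upTo 13)
star-residues = from-yes (all? (λ r → any? (λ o → + 13 ∣? + r - height o) star) (upTo 13))

star-distinct-residues : All (λ o → All (λ o′ → + 13 ∣ height o - height o′ → o ≡ o′) star) star
star-distinct-residues =
  from-yes (all? (λ o → all? (λ o′ → (+ 13 ∣? height o - height o′) →-dec (o ≟ₚ o′)) star) star)

-- Unfolding this search makes type checking explode.
abstract
  star-covers : ∀ v → ∃[ o ] o ∈ star × + 13 ∣ height (v ⊖ o)
  star-covers v =
    find (Any.map divides-shifted (All.lookup star-residues (∈-upTo⁺ (n%ℕd<d (height v) 13))))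
    where
    r : ℕ
    r = height v %ℕ 13
    q : ℤ
    q = height v /ℕ 13
    regroup : ∀ r q o → (r - o) ℤ.+ q ≡ (r ℤ.+ q) - o
    regroup = solve-∀
    divides-shifted : ∀ {o} → + 13 ∣ + r - height o → + 13 ∣ height (v ⊖ o)
    divides-shifted {o} d = subst (+ 13 ∣_)
      (trans (regroup (+ r) (q ℤ.* + 13) (height o))
        (trans (cong (_- height o) (sym (a≡a%ℕn+[a/ℕn]*n (height v) 13))) (sym (height-⊖ v o))))
      (∣m∣n⇒∣m+n d (divides q refl))

-- A common point t + o = t′ + o′ makes the heights of o and o′ congruent modulo 13; distinct
-- residues force o = o′, hence t = t′.
tiles-disjoint : ∀ {t t′} → + 13 ∣ height t → + 13 ∣ height t′ → t ≢ t′ → Disjoint (tile t) (tile t′)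
tiles-disjoint {t} {t′} d d′ t≢t′ (v∈ , v∈′)
  with o , o∈ , refl ← ∈-map⁻ (t ⊕_) v∈ | o′ , o∈′ , eq ← ∈-map⁻ (t′ ⊕_) v∈′ =
  t≢t′ (⊕-cancelʳ o (trans eq (cong (t′ ⊕_) (sym o≡o′))))
  where
  rearrange : ∀ x y z w → x ℤ.+ y ≡ z ℤ.+ w → z - x ≡ y - w
  rearrange x y z w e = trans (lem₁ x y z) (trans (cong (λ u → z ℤ.+ y - u) e) (lem₂ y z w))
    where
    lem₁ : ∀ x y z → z - x ≡ z ℤ.+ y - (x ℤ.+ y)
    lem₁ = solve-∀
    lem₂ : ∀ y z w → z ℤ.+ y - (z ℤ.+ w) ≡ y - w
    lem₂ = solve-∀
  o≡o′ : o ≡ o′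
  o≡o′ = All.lookup (All.lookup star-distinct-residues o∈) o∈′
    (subst (+ 13 ∣_) (rearrange (height t) (height o) (height t′) (height o′)
      (trans (sym (height-⊕ t o)) (trans (cong height eq) (height-⊕ t′ o′))))
      (∣m∣n⇒∣m-n d′ d))

-- The radius 4 is the distance between opposite tips, such as (1,1) and (-1,-1); it fixes the width
-- of the boundary layer.
star-diameter : All (λ o → All (λ o′ → (o′ ⊖ o) ∈ ball 4 origin) star) star
star-diameter = from-yes (all? (λ o → all? (λ o′ → (o′ ⊖ o) ∈? ball 4 origin) star) star)

ball-⊕ : ∀ d {q} v → q ∈ ball d origin → v ⊕ q ∈ ball d v
ball-⊕ d v q∈ with q′ , q′∈ , refl ← ∈-map⁻ (origin ⊕_) q∈ =
  ∈-map⁺ (v ⊕_) (subst (_∈ _) (cong₂ _,_ (sym (ℤ.+-identityˡ _)) (sym (ℤ.+-identityˡ _))) q′∈)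

-- The centre of the tile containing `v`, a different notion from the anchor of a rhombus.
anchor : Pt → Pt
anchor v = v ⊖ proj₁ (star-covers v)

∈-tile-anchor : ∀ v → v ∈ tile (anchor v)
∈-tile-anchor v = let o , o∈ , _ = star-covers v in
  subst (_∈ tile (v ⊖ o)) (⊖-⊕ v o) (∈-map⁺ ((v ⊖ o) ⊕_) o∈)

13∣anchor : ∀ v → + 13 ∣ height (anchor v)
13∣anchor v = proj₂ (proj₂ (star-covers v))

tile⊆ball : ∀ v → tile (anchor v) ⊆ ball 4 v
tile⊆ball v w∈ =
  let o , o∈ , _ = star-covers v
      o′ , o′∈ , w≡ = ∈-map⁻ ((v ⊖ o) ⊕_) w∈
  in subst (_∈ ball 4 v) (sym (trans w≡ (⊖-⊕-comm v o o′)))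
       (ball-⊕ 4 v (All.lookup (All.lookup star-diameter o∈) o′∈))

-- Counting rhombi away from the boundary

module _ (V : List Pt) (d : ℕ) (region : Pt → List Pt) (region⊆ball : ∀ v → region v ⊆ ball d v) where

  within? : ∀ v → Dec (All (_∈ V) (region v))
  within? v = all? (_∈? V) (region v)

  near? : ∀ W → Dec (nearBoundary d V W ≡ true)
  near? W = nearBoundary d V W Bool.≟ true

  -- `v` is a vertex of `W`, so its ball is among those that `nearBoundary` tests for lying in `V`.
  interior⇒within : ∀ {v W} → W ∈ rhombiAt v → nearBoundary d V W ≢ true → All (_∈ V) (region v)
  interior⇒within {v} {W} W∈ far with allIn V (concatMap (ball d) W) in eq
  ... | false = contradiction refl far
  ... | true = All.tabulate λ w∈ → allIn⁻ V (concatMap (ball d) W) eq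
    (∈-concatMap⁺ (ball d) (Any.map (λ { refl → region⊆ball v w∈ }) (rhombiAt-head W∈)))

  inside? : ∀ W → Dec (allIn V W ≡ true)
  inside? W = allIn V W Bool.≟ true

  rhombiIn : List (List Pt) → List (List Pt)
  rhombiIn = filter inside?

  boundaryIn : List (List Pt) → List (List Pt)
  boundaryIn = filter near? ∘ rhombiIn

  rhombiAt-count : ∀ v → length (rhombiIn (rhombiAt v)) ≤
    length (boundaryIn (rhombiAt v)) + 3 * length (filter within? [ v ])
  rhombiAt-count v with within? v
  -- Three rhombi are anchored at `v`; if `region v` leaves `V`, all of them on the board are
  -- boundary rhombi.
  ... | yes _ = ≤-trans (length-filter inside? (rhombiAt v)) (m≤n+m 3 _)
  ... | no ¬c = ≤-trans
    (≤-reflexive (sym (cong length (filter-all near? (All.filter⁺ inside? (All.tabulate near))))))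
    (m≤m+n _ 0)
    where
    near : ∀ {W} → W ∈ rhombiAt v → nearBoundary d V W ≡ true
    near {W} W∈ with near? W
    ... | yes n = n
    ... | no ¬n = contradiction (interior⇒within W∈ ¬n) ¬c

  -- `rhombi V` uses `V` both as list of anchors and as board; the induction runs over the anchors
  -- `X` with the board fixed, and is applied at `X = V`.
  rhombi-count : ∀ X → length (rhombiIn (concatMap rhombiAt X)) ≤
    length (boundaryIn (concatMap rhombiAt X)) + 3 * length (filter within? X)
  rhombi-count [] = z≤n
  rhombi-count (v ∷ X) = begin
    length (rhombiIn (rhombiAt v ++ rest))
      ≡⟨ cong length (filter-++ inside? (rhombiAt v) rest) ⟩
    length (rhombiIn (rhombiAt v) ++ rhombiIn rest)
      ≡⟨ length-++ (rhombiIn (rhombiAt v)) ⟩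
    length (rhombiIn (rhombiAt v)) + length (rhombiIn rest)
      ≤⟨ +-mono-≤ (rhombiAt-count v) (rhombi-count X) ⟩
    (b + 3 * c) + (b′ + 3 * c′)
      ≡⟨ regroup b c b′ c′ ⟩
    (b + b′) + 3 * (c + c′)
      ≡⟨ cong₂ (λ m n → m + 3 * n) boundary-++ within-++ ⟨
    length (boundaryIn (rhombiAt v ++ rest)) + 3 * length (filter within? (v ∷ X)) ∎
    where
    open ≤-Reasoning
    rest = concatMap rhombiAt X
    b = length (boundaryIn (rhombiAt v))
    b′ = length (boundaryIn rest)
    c = length (filter within? [ v ])
    c′ = length (filter within? X)
    regroup : ∀ b c b′ c′ → (b + 3 * c) + (b′ + 3 * c′) ≡ (b + b′) + 3 * (c + c′)
    regroup = ℕ-solve-∀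
    boundary-++ : length (boundaryIn (rhombiAt v ++ rest)) ≡ b + b′
    boundary-++ = trans (cong (length ∘ filter near?) (filter-++ inside? (rhombiAt v) rest))
      (trans (cong length (filter-++ near? (rhombiIn (rhombiAt v)) (rhombiIn rest)))
        (length-++ (boundaryIn (rhombiAt v))))
    within-++ : length (filter within? (v ∷ X)) ≡ c + c′
    within-++ = trans (cong length (filter-++ within? [ v ] X)) (length-++ (filter within? [ v ]))

-- Counting stars and the final bound

module _ (V : List Pt) (V! : Unique V) where

  covered? : ∀ v → Dec (All (_∈ V) (tile (anchor v)))
  covered? = within? V 4 (tile ∘ anchor) tile⊆ball

  anchors : List Pt
  anchors = deduplicate _≟ₚ_ (map anchor (filter covered? V))

  anchor⁻ : ∀ {t} → t ∈ anchors → ∃[ v ] All (_∈ V) (tile (anchor v)) × t ≡ anchor v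
  anchor⁻ t∈ with v , v∈ , eq ← ∈-map⁻ anchor (∈-deduplicate⁻ _≟ₚ_ (map anchor (filter covered? V)) t∈) =
    v , proj₂ (∈-filter⁻ covered? {xs = V} v∈) , eq

  -- The covered points are distinct and lie in the tiles centred at `anchors`, of 13 points each.
  covered-count : length (filter covered? V) ≤ 13 * length anchors
  covered-count = ≤-trans (Unique-⊆⇒length-≤ (Unique.filter⁺ covered? V!) in-tile)
      (≤-reflexive (tiles-length anchors))
    where
    in-tile : filter covered? V ⊆ concatMap tile anchors
    in-tile {v} v∈ = ∈-concatMap⁺ tile (Any.map (λ { refl → ∈-tile-anchor v })
      (∈-deduplicate⁺ _≟ₚ_ (∈-map⁺ anchor v∈)))
    tiles-length : ∀ ts → length (concatMap tile ts) ≡ 13 * length ts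
    tiles-length [] = refl
    tiles-length (t ∷ ts) = trans (cong (λ n → 13 + n) (tiles-length ts)) (sym (*-suc 13 (length ts)))

  anchors≤2*SC : length anchors ≤ 2 * SC V (rhombi V) 4
  anchors≤2*SC = subst (_≤ 2 * SC V (rhombi V) 4) (length-map tile anchors)
    (regions≤2*SC (AllPairs.map⁺ (disjoint (deduplicate-! _) 13∣anchors))
                  (All.map⁺ (All.tabulate inside))
                  (All.map⁺ (All.tabulate λ {t} t∈ → tile-winnable t (inside t∈))))
    where
    open SumOfGames (rhombi V) 4 (s≤s z≤n)
    inside : ∀ {t} → t ∈ anchors → tile t ⊆ V
    inside t∈ with v , t⊆V , refl ← anchor⁻ t∈ = All.lookup t⊆V
    13∣anchors : All (λ t → + 13 ∣ height t) anchors
    13∣anchors = All.tabulate λ t∈ → let v , _ , eq = anchor⁻ t∈ in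
      subst (λ t → + 13 ∣ height t) (sym eq) (13∣anchor v)
    disjoint : ∀ {ts} → Unique ts → All (λ t → + 13 ∣ height t) ts →
      AllPairs (λ t t′ → Disjoint (tile t) (tile t′)) ts
    disjoint [] [] = []
    disjoint (t≢ ∷ ts!) (d ∷ ds) =
      All.tabulate (λ t∈ → tiles-disjoint d (All.lookup ds t∈) (All.lookup t≢ t∈)) ∷ disjoint ts! ds

  -- 78 = 3 · 13 · 2: rhombi per anchor, points per star, and one star won out of two.
  nWin≤ : nWin V ≤ nBoundary 4 V + 78 * SC V (rhombi V) 4
  nWin≤ = begin
    nWin V                                             ≤⟨ rhombi-count V 4 (tile ∘ anchor) tile⊆ball V ⟩
    nBoundary 4 V + 3 * length (filter covered? V)     ≤⟨ +-monoʳ-≤ (nBoundary 4 V) (*-monoʳ-≤ 3 covered-count) ⟩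
    nBoundary 4 V + 3 * (13 * length anchors)          ≤⟨ +-monoʳ-≤ (nBoundary 4 V) (*-monoʳ-≤ 3 (*-monoʳ-≤ 13 anchors≤2*SC)) ⟩
    nBoundary 4 V + 3 * (13 * (2 * SC V (rhombi V) 4)) ≡⟨ cong (λ n → nBoundary 4 V + n) (assoc (SC V (rhombi V) 4)) ⟩
    nBoundary 4 V + 78 * SC V (rhombi V) 4             ∎
    where
    open ≤-Reasoning
    assoc : ∀ x → 3 * (13 * (2 * x)) ≡ 78 * x
    assoc x = trans (cong (3 *_) (sym (*-assoc 13 2 x))) (sym (*-assoc 3 26 x))

-- For positive `k`, division by 78k turns the conclusion into SC ≥ n/78 - n/k; arbitrary `k`
-- expresses the error o(n).
theorem17 : (V : ℕ → List Pt)
    → (∀ m → Unique (V m))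
    → (∀ B → Σ ℕ (λ M → ∀ m → m ≥ M → B ≤ nWin (V m)))
    → (∀ d k → Σ ℕ (λ M → ∀ m → m ≥ M → k * nBoundary d (V m) ≤ nWin (V m)))
    → ∀ k → Σ ℕ (λ M → ∀ m → m ≥ M →
    k * nWin (V m) ∸ 78 * nWin (V m) ≤ 78 * k * SC (V m) (rhombi (V m)) 4)
theorem17 V V! _ boundary-small k with M , small ← boundary-small 4 k =
  -- `k` times the boundary count is at most n, hence at most the 78n that is subtracted.
  M , λ m m≥M → scale k 78 (nWin≤ (V m) (V! m)) (≤-trans (small m m≥M) (m≤n*m _ 78))
  where
  scale : ∀ {n b c x} k u → n ≤ b + u * x → k * b ≤ c → k * n ∸ c ≤ u * k * x
  scale {n} {b} {c} {x} k u n≤ kb≤c = m≤n+o⇒m∸n≤o (k * n) c (begin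
    k * n                 ≤⟨ *-monoʳ-≤ k n≤ ⟩
    k * (b + u * x)       ≡⟨ distribute k b u x ⟩
    k * b + u * k * x     ≤⟨ +-monoˡ-≤ (u * k * x) kb≤c ⟩
    c + u * k * x         ∎)
    where
    open ≤-Reasoning
    distribute : ∀ k b u x → k * (b + u * x) ≡ k * b + u * k * x
    distribute = ℕ-solve-∀
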